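{- Let $m$ and $r$ be integers with $1\leq r\leq m-3$, and let $PS(r,m-r)$ be the path-star graph of order $m$ (defined in the context). Then every 2-connected graph $G$ with minimum degree $\delta(G)\geq m+2$ contains a subgraph $T$ isomorphic to $PS(r,m-r)$ such that $G-V(T)$ is 2-connected.
   Context: All graphs are finite, simple (no loops, no multiple edges). A graph is 2-connected if its vertex-connectivity is at least 2. For $U\subseteq V(G)$, $G-U$ is the subgraph induced by $V(G)\setminus U$. A star is a tree that has exactly one vertex of degree greater than one. The path-star graph $PS(r,m-r)$ is obtained from the disjoint union of a path of order $r+1$ and a star of order $m-r$ by identifying one end vertex of the path with one vertex of degree one of the star; it has order $m$. -}

module Defs where

open import Data.Nat using (ℕ; zero; suc; _+_; _≤_; _<_)
open import Data.Fin using (Fin; toℕ)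
open import Data.Bool using (Bool; true; false)
open import Data.List using (List; []; _∷_; filter; length)
open import Data.List.Relation.Unary.All using (All)
open import Data.Fin.Subset using (Subset; _∈_; _∉_; ∣_∣; ⁅_⁆; _─_)
open import Data.Fin.Subset.Properties using (_∈?_)
open import Data.Product using (Σ; _×_; ∃)
open import Data.Sum using (_⊎_)
open import Data.Vec using (allFin)
open import Relation.Binary.PropositionalEquality using (_≡_)
open import Relation.Nullary using (¬_; Dec; yes; no)
open import Relation.Nullary.Decidable using (⌊_⌋)
open import Function.Definitions using (Injective)
open import Data.Vec using (Vec; toList)

record Graph (n : ℕ) : Set₁ where
  field
    Adj     : Fin n → Fin n → Set
    adj?    : (u v : Fin n) → Dec (Adj u v)
    sym     : ∀ {u v} → Adj u v → Adj v u
    irrefl  : ∀ {u} → ¬ Adj u u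
open Graph public

degree : ∀ {n} → Graph n → Fin n → ℕ
degree G v = length (filter (λ u → adj? G v u) (toList (allFin _)))

MinDegree≥ : ∀ {n} → Graph n → ℕ → Set
MinDegree≥ {n} G k = (v : Fin n) → k ≤ degree G v

data WalkIn {n} (G : Graph n) (S : Subset n) : Fin n → Fin n → Set where
  stay : ∀ {u} → u ∈ S → WalkIn G S u u
  step : ∀ {u v w} → u ∈ S → Adj G u v → WalkIn G S v w → WalkIn G S u w

-- the induced subgraph G[S] is connected
-- (convention: the empty graph counts as connected; irrelevant below)
ConnectedOn : ∀ {n} → Graph n → Subset n → Set
ConnectedOn G S = ∀ u v → u ∈ S → v ∈ S → WalkIn G S u v

TwoConnectedOn : ∀ {n} → Graph n → Subset n → Set
TwoConnectedOn G S =
  (3 ≤ ∣ S ∣) × ConnectedOn G S × (∀ x → x ∈ S → ConnectedOn G (S ─ ⁅ x ⁆))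

full : ∀ {n} → Subset n
full = Data.Vec.replicate _ true
  where import Data.Vec

TwoConnected : ∀ {n} → Graph n → Set
TwoConnected G = TwoConnectedOn G full

-- Edges of the path-star graph PS(r, m-r) on vertices 0,…,m-1:
-- path 0 - 1 - … - r (order r+1); star with centre r+1 whose leaves are
-- r (identified with the end of the path) and r+2, …, m-1 (order m-r).
-- Directed version; the edge relation is its symmetrization.
PSEdge→ : ℕ → ℕ → ℕ → ℕ → Set
PSEdge→ r m i j = (suc i ≡ j × j ≤ suc r) ⊎ (i ≡ suc r × suc (suc r) ≤ j × j < m)

PSEdge : (r m : ℕ) → Fin m → Fin m → Set
PSEdge r m i j = PSEdge→ r m (toℕ i) (toℕ j) ⊎ PSEdge→ r m (toℕ j) (toℕ i)

image : ∀ {m n} → (Fin m → Fin n) → Subset n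
image {m} f = Data.Vec.tabulate (λ v → ⌊ Data.Fin.Properties.any? (λ i → f i Data.Fin.≟ v) ⌋)
  where import Data.Vec; import Data.Fin; import Data.Fin.Properties

outside : ∀ {m n} → (Fin m → Fin n) → Subset n
outside f = Data.Vec.tabulate (λ v → Data.Bool.not ⌊ Data.Fin.Properties.any? (λ i → f i Data.Fin.≟ v) ⌋)
  where import Data.Vec; import Data.Bool; import Data.Fin; import Data.Fin.Properties

IsPSEmbedding : ∀ {n} → Graph n → (r m : ℕ) → (Fin m → Fin n) → Set
IsPSEmbedding G r m f = Injective _≡_ _≡_ f × (∀ i j → PSEdge r m i j → Adj G (f i) (f j))

{-# OPTIONS --safe #-}

-- Take B maximal such that G[B] stays connected after deleting any one vertex and V ∖ B contains a
-- copy T of the path-star; an edge of G is a possible first B.  We show V = B ∪ V(T).  If not: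
--
-- If every vertex outside B has at most one neighbour in B, a shortest ear P of B is such that each
-- vertex outside B has at most three neighbours in B ∪ P (four would allow a shortcut).  So
-- V ∖ (B ∪ P) has minimum degree at least m − 1, a copy is found there greedily, and B ∪ P contradicts
-- maximality.
--
-- Otherwise some a outside B is attached: it has two neighbours in B.  It is enough to find a copy
-- avoiding B and one attached vertex, which happens as soon as a path with r + 2 vertices outside B
-- ends in an unattached vertex u and misses an attached one, since u then has enough other neighbours
-- to serve as the centre of the star.  Start from a vertex outside B ∪ V(T); we may assume that all
-- such vertices are unattached.  Walking through these vertices and, when stuck, along T, gives a path
-- with r + 2 vertices.  Then repeatedly prepend to it a neighbour of its unattached end and drop its
-- last vertex: either an attached vertex off the path is met, or a is eventually pushed off the path.
module Submission where

open import Defs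
open import Data.Nat using (ℕ; zero; suc; _+_; _≤_; _<_; z≤n; s≤s; _≤?_; _<?_)
open import Data.Nat.Properties
  using (≤-refl; ≤-trans; ≤-antisym; ≤-reflexive; <-irrefl; ≰⇒>; ≤-pred; 1+n≢n; n≤1+n; m≤m+n; m≤n+m;
         +-comm; +-suc; +-monoˡ-≤; +-monoʳ-≤; +-mono-≤; suc-injective; m≤n⇒m⊓n≡m; m≤n⇒∃[o]m+o≡n)
open import Data.Nat.Tactic.RingSolver using (solve-∀)
open import Data.Fin using (Fin; toℕ; fromℕ<; _≟_) renaming (zero to fzero; suc to fsuc)
open import Data.Fin.Properties using (any?; toℕ-injective; toℕ<n; toℕ-fromℕ<)
open import Data.Fin.Subset using (Subset; _∈_; _∉_; _⊆_; ∣_∣; ⁅_⁆; _─_; _-_; _∪_; ∁; ⊥)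
open import Data.Fin.Subset.Properties
  using (_∈?_; ∉⊥; x∈⁅x⁆; x∈⁅y⁆⇒x≡y; x∈p∪q⁺; x∈p∪q⁻; p─q⊆p; x∈p∧x≢y⇒x∈p-y;
         x∈p⇒∣p-x∣<∣p∣; p⊂q⇒∣p∣<∣q∣; p⊂q⇒∁p⊃∁q; ⊆-antisym)
open import Data.List using (List; []; _∷_; _++_; [_]; length; filter; take)
open import Data.List.Properties
  using (length-++; length-take; take-all; ++-assoc)
open import Data.List.Membership.Propositional using () renaming (_∈_ to _∈ˡ_; _∉_ to _∉ˡ_)
open import Data.List.Membership.Propositional.Properties
  using (∈-++⁺ˡ; ∈-++⁺ʳ; ∈-++⁻; ∈-∃++; ∈-filter⁺; ∈-filter⁻)
import Data.List.Membership.DecPropositional as DecMembership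
open import Data.List.Relation.Unary.Any using (here; there)
open import Data.List.Relation.Unary.All as All using (All; []; _∷_)
open import Data.List.Relation.Unary.All.Properties as AllP using (¬Any⇒All¬; All¬⇒¬Any)
open import Data.List.Relation.Unary.AllPairs using ([]; _∷_)
open import Data.List.Relation.Unary.Linked using (Linked; []; [-]; _∷_)
open import Data.List.Relation.Unary.Unique.Propositional using (Unique)
import Data.List.Relation.Unary.Unique.Propositional.Properties as Unique
open import Data.Product using (Σ; ∃; ∃₂; _×_; _,_; proj₁; proj₂)
open import Data.Sum using (_⊎_; inj₁; inj₂; [_,_]′)
open import Data.Bool using (true; not)
import Data.Vec as Vec
open import Data.Vec.Properties using ([]=⇒lookup; lookup⇒[]=; lookup∘tabulate)
open import Function using (_∘_; id)
open import Relation.Unary using (Decidable)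
open import Relation.Nullary using (¬_; Dec; yes; no; contradiction)
open import Relation.Nullary.Decidable using (_×-dec_; ¬?; ⌊_⌋)
open import Relation.Binary.PropositionalEquality
  using (_≡_; _≢_; refl; cong; subst; trans) renaming (sym to ≡-sym)

-- Lists, repetitions and positions.

private
  variable
    A : Set
    n : ℕ

_∈ˡ?_ : (x : Fin n) (xs : List (Fin n)) → Dec (x ∈ˡ xs)
_∈ˡ?_ = DecMembership._∈?_ _≟_

∀⊎∃ : {P Q : Fin n → Set} → (∀ v → P v ⊎ Q v) → (∀ v → P v) ⊎ ∃ Q
∀⊎∃ {zero}  _ = inj₁ λ ()
∀⊎∃ {suc n} d with d fzero | ∀⊎∃ (d ∘ fsuc)
... | inj₂ q | _            = inj₂ (fzero , q)
... | inj₁ _ | inj₂ (v , q) = inj₂ (fsuc v , q)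
... | inj₁ p | inj₁ ps      = inj₁ λ { fzero → p ; (fsuc v) → ps v }

∉⇒All≢ : ∀ {x : A} {xs} → x ∉ˡ xs → All (x ≢_) xs
∉⇒All≢ = ¬Any⇒All¬ _

All≢⇒∉ : ∀ {x : A} {xs} → All (x ≢_) xs → x ∉ˡ xs
All≢⇒∉ = All¬⇒¬Any

take-⊆ : ∀ k {xs : List A} {y} → y ∈ˡ take k xs → y ∈ˡ xs
take-⊆ (suc k) {_ ∷ _} (here eq) = here eq
take-⊆ (suc k) {_ ∷ _} (there p) = there (take-⊆ k p)

take-take-⊆ : ∀ j k {xs : List A} {y} → y ∈ˡ take j (take k xs) → y ∈ˡ take j xs
take-take-⊆ (suc j) (suc k) {_ ∷ _} (here eq) = here eq
take-take-⊆ (suc j) (suc k) {_ ∷ _} (there p) = there (take-take-⊆ j k p)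

length-take-≤ : ∀ k (xs : List A) → k ≤ length xs → length (take k xs) ≡ k
length-take-≤ k xs k≤ = trans (length-take k xs) (m≤n⇒m⊓n≡m k≤)

linked-take : ∀ {R : A → A → Set} k {xs} → Linked R xs → Linked R (take k xs)
linked-take zero          _        = []
linked-take (suc k)       []       = []
linked-take (suc zero)    [-]      = [-]
linked-take (suc (suc _)) [-]      = [-]
linked-take (suc zero)    (_ ∷ _)  = [-]
linked-take (suc (suc k)) (r ∷ rs) = r ∷ linked-take (suc k) rs

linked-++ʳ : ∀ {R : A → A → Set} xs {ys} → Linked R (xs ++ ys) → Linked R ys
linked-++ʳ []           l       = l
linked-++ʳ (_ ∷ [])     [-]     = []
linked-++ʳ (_ ∷ [])     (_ ∷ l) = l
linked-++ʳ (_ ∷ x ∷ xs) (_ ∷ l) = linked-++ʳ (x ∷ xs) l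

unique-++ʳ : ∀ (xs : List A) {ys} → Unique (xs ++ ys) → Unique ys
unique-++ʳ []       u       = u
unique-++ʳ (_ ∷ xs) (_ ∷ u) = unique-++ʳ xs u

unique-++-disjoint : ∀ (xs : List A) {ys x} → Unique (xs ++ ys) → x ∈ˡ xs → x ∉ˡ ys
unique-++-disjoint (x ∷ xs) (f ∷ _) (here refl) q = All≢⇒∉ f (∈-++⁺ʳ xs q)
unique-++-disjoint (_ ∷ xs) (_ ∷ u) (there p)   q = unique-++-disjoint xs u p q

unique-⊆⇒length-≤ : ∀ {xs ys : List A} → Unique xs → (∀ {x} → x ∈ˡ xs → x ∈ˡ ys) →
                    length xs ≤ length ys
unique-⊆⇒length-≤ {xs = []}     _       _   = z≤n
unique-⊆⇒length-≤ {xs = x ∷ xs} (f ∷ u) sub with ∈-∃++ (sub (here refl))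
... | as , bs , refl = ≤-trans (s≤s (unique-⊆⇒length-≤ u sub′)) (≤-reflexive lengths)
  where
  sub′ : ∀ {y} → y ∈ˡ xs → y ∈ˡ as ++ bs
  sub′ {y} p with ∈-++⁻ as (sub (there p))
  ... | inj₁ q           = ∈-++⁺ˡ q
  ... | inj₂ (here refl) = contradiction p (All≢⇒∉ f)
  ... | inj₂ (there q)   = ∈-++⁺ʳ as q
  lengths : suc (length (as ++ bs)) ≡ length (as ++ x ∷ bs)
  lengths rewrite length-++ as {bs} | length-++ as {x ∷ bs} = ≡-sym (+-suc (length as) (length bs))

split-suffix : ∀ k (xs : List A) → k ≤ length xs →
               ∃₂ λ as bs → xs ≡ as ++ bs × length bs ≡ k
split-suffix k []       z≤n = [] , [] , refl , refl
split-suffix k (x ∷ xs) p with k ≤? length xs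
... | yes q with split-suffix k xs q
...   | as , bs , refl , eq = x ∷ as , bs , refl , eq
split-suffix k (x ∷ xs) p | no ¬q = [] , x ∷ xs , refl , ≤-antisym (≰⇒> ¬q) p

unique⊎repeat : ∀ (xs : List (Fin n)) →
  Unique xs ⊎ (∃₂ λ ys x → ∃₂ λ zs ws → xs ≡ ys ++ x ∷ zs ++ x ∷ ws)
unique⊎repeat [] = inj₁ []
unique⊎repeat (x ∷ xs) with x ∈ˡ? xs
... | yes p with ∈-∃++ p
...   | zs , ws , refl = inj₂ ([] , x , zs , ws , refl)
unique⊎repeat (x ∷ xs) | no p with unique⊎repeat xs
... | inj₁ u = inj₁ (∉⇒All≢ p ∷ u)
... | inj₂ (ys , y , zs , ws , refl) = inj₂ (x ∷ ys , y , zs , ws , refl)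

module _ {A : Set} {P : A → Set} (P? : Decidable P) where

  late-hit : ∀ j (xs : List A) → suc j ≤ length (filter P? xs) →
    ∃₂ λ (zs : List A) (q : A) → ∃ λ ws → xs ≡ zs ++ q ∷ ws × P q × j ≤ length zs
  late-hit j (x ∷ xs) h with P? x
  late-hit j (x ∷ xs) h | no _ with late-hit j xs h
  ... | zs , q , ws , refl , pq , le = x ∷ zs , q , ws , refl , pq , ≤-trans le (n≤1+n _)
  late-hit zero    (x ∷ xs) h       | yes px = [] , x , xs , refl , px , z≤n
  late-hit (suc j) (x ∷ xs) (s≤s h) | yes px with late-hit j xs h
  ... | zs , q , ws , refl , pq , le = x ∷ zs , q , ws , refl , pq , s≤s le

  -- The first hit is `p` and the one numbered `2 + j` is `q`; the `j` hits between them lie in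
  -- `zs`. For an ear and the neighbours of a vertex `v`, a detour through `v` can then bypass `zs`.
  far-hits : ∀ j (xs : List A) → 2 + j ≤ length (filter P? xs) →
    ∃₂ λ ys p → ∃₂ λ (zs : List A) (q : A) → ∃ λ ws →
      xs ≡ ys ++ p ∷ zs ++ q ∷ ws × P p × P q × j ≤ length zs
  far-hits j (x ∷ xs) h with P? x
  far-hits j (x ∷ xs) h | no _ with far-hits j xs h
  ... | ys , p , zs , q , ws , refl , rest = x ∷ ys , p , zs , q , ws , refl , rest
  far-hits j (x ∷ xs) (s≤s h) | yes px with late-hit j xs h
  ... | zs , q , ws , refl , pq , le = [] , x , zs , q , ws , refl , px , pq , le

-- Positions are counted from the end of the list, so that consing does not shift them.
data At {A : Set} : List A → ℕ → A → Set where
  head : ∀ {x xs} → At (x ∷ xs) (length xs) x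
  tail : ∀ {x xs k y} → At xs k y → At (x ∷ xs) k y

at-< : ∀ {xs : List A} {k y} → At xs k y → k < length xs
at-< head     = ≤-refl
at-< (tail p) = ≤-trans (at-< p) (n≤1+n _)

at-total : ∀ (xs : List A) {k} → k < length xs → ∃ (At xs k)
at-total (x ∷ xs) {k} (s≤s p) with k <? length xs
... | yes q = let y , a = at-total xs q in y , tail a
... | no ¬q with ≤-antisym p (≤-pred (≰⇒> ¬q))
...   | refl = x , head

at-∈ : ∀ {xs : List A} {k y} → At xs k y → y ∈ˡ xs
at-∈ head     = here refl
at-∈ (tail p) = there (at-∈ p)

∈-at : ∀ {xs : List A} {y} → y ∈ˡ xs → ∃ λ k → At xs k y
∈-at (here refl) = _ , head
∈-at (there p)   = let k , a = ∈-at p in k , tail a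

at-functional : ∀ {xs : List A} {k x y} → At xs k x → At xs k y → x ≡ y
at-functional head     head     = refl
at-functional head     (tail q) = contradiction (at-< q) (<-irrefl refl)
at-functional (tail p) head     = contradiction (at-< p) (<-irrefl refl)
at-functional (tail p) (tail q) = at-functional p q

at-injective : ∀ {xs : List A} {i j x} → Unique xs → At xs i x → At xs j x → i ≡ j
at-injective _       head     head     = refl
at-injective (f ∷ _) head     (tail q) = contradiction (at-∈ q) (All≢⇒∉ f)
at-injective (f ∷ _) (tail p) head     = contradiction (at-∈ p) (All≢⇒∉ f)
at-injective (_ ∷ u) (tail p) (tail q) = at-injective u p q

at-++ʳ⁻ : ∀ xs {ys : List A} {k y} → At (xs ++ ys) k y → k < length ys → At ys k y
at-++ʳ⁻ []       p        _  = p
at-++ʳ⁻ (_ ∷ xs) head     lt = contradiction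
  (≤-trans lt (≤-trans (m≤n+m _ (length xs)) (≤-reflexive (≡-sym (length-++ xs))))) (<-irrefl refl)
at-++ʳ⁻ (_ ∷ xs) (tail p) lt = at-++ʳ⁻ xs p lt

at-++ˡ : ∀ xs {ys : List A} {k y} → At (xs ++ ys) k y → length ys ≤ k → y ∈ˡ xs
at-++ˡ []       p        le = contradiction (≤-trans (at-< p) le) (<-irrefl refl)
at-++ˡ (x ∷ xs) head     le = here refl
at-++ˡ (x ∷ xs) (tail p) le = there (at-++ˡ xs p le)

at-linked : ∀ {R : A → A → Set} {xs k x y} → Linked R xs →
            At xs (suc k) x → At xs k y → R x y
at-linked {R = R} l p q = go l p q refl
  where
  go : ∀ {xs i k x y} → Linked R xs → At xs i x → At xs k y → i ≡ suc k → R x y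
  go [-]     head (tail ()) _
  go [-]     (tail ()) _ _
  go (_ ∷ _) head     head            eq = contradiction eq (1+n≢n ∘ ≡-sym)
  go (r ∷ _) head     (tail head)     _  = r
  go (_ ∷ _) head     (tail (tail q)) eq = contradiction (at-< q) (<-irrefl (≡-sym (suc-injective eq)))
  go (_ ∷ l) (tail p) (tail q)        eq = go l p q eq
  go (_ ∷ _) (tail p) head            refl =
    contradiction (≤-trans (n≤1+n _) (at-< p)) (<-irrefl refl)

unique-tabulate : ∀ (f : Fin n → A) → (∀ {i j} → f i ≡ f j → i ≡ j) →
                  Unique (Vec.toList (Vec.tabulate f))
unique-tabulate {n = zero}  f inj = []
unique-tabulate {n = suc n} f inj =
  ∉⇒All≢ (λ p → let i , eq = origin (f ∘ fsuc) p in contradiction (inj eq) λ ())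
  ∷ unique-tabulate (f ∘ fsuc) (λ eq → suc-inj (inj eq))
  where
  suc-inj : ∀ {m} {i j : Fin m} → fsuc i ≡ fsuc j → i ≡ j
  suc-inj refl = refl
  origin : ∀ {m y} (g : Fin m → _) → y ∈ˡ Vec.toList (Vec.tabulate g) → ∃ λ i → y ≡ g i
  origin {suc m} g (here eq) = fzero , eq
  origin {suc m} g (there p) = let i , eq = origin (g ∘ fsuc) p in fsuc i , eq

-- Finite subsets.

x∉p-x : ∀ (p : Subset n) x → x ∉ p - x
x∉p-x (_ Vec.∷ p) (fsuc x) (Vec.there q) = x∉p-x p x q

three-elements : ∀ {p : Subset n} {x y z} → x ∈ p → y ∈ p → z ∈ p →
                 y ≢ x → z ≢ x → z ≢ y → 3 ≤ ∣ p ∣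
three-elements {p = p} {x} {y} {z} x∈ y∈ z∈ y≢x z≢x z≢y =
  ≤-trans (s≤s (≤-trans (s≤s (≤-trans (s≤s z≤n) (x∈p⇒∣p-x∣<∣p∣ z∈″))) (x∈p⇒∣p-x∣<∣p∣ y∈′)))
          (x∈p⇒∣p-x∣<∣p∣ x∈)
  where
  y∈′ : y ∈ p - x
  y∈′ = x∈p∧x≢y⇒x∈p-y y∈ y≢x
  z∈″ : z ∈ p - x - y
  z∈″ = x∈p∧x≢y⇒x∈p-y (x∈p∧x≢y⇒x∈p-y z∈ z≢x) z≢y

∈-outside⁺ : ∀ {m} (f : Fin m → Fin n) {v} → (∀ i → f i ≢ v) → v ∈ outside f
∈-outside⁺ f {v} f≢v = lookup⇒[]= v (outside f) (trans (lookup∘tabulate _ v) missed)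
  where
  missed : not ⌊ any? (λ i → f i ≟ v) ⌋ ≡ true
  missed with any? (λ i → f i ≟ v)
  ... | yes (i , eq) = contradiction eq (f≢v i)
  ... | no _         = refl

∈-outside⁻ : ∀ {m} (f : Fin m → Fin n) {v} → v ∈ outside f → ∀ i → f i ≢ v
∈-outside⁻ f {v} v∈ i eq = hit (trans (≡-sym (lookup∘tabulate _ v)) ([]=⇒lookup v∈))
  where
  hit : not ⌊ any? (λ i → f i ≟ v) ⌋ ≢ true
  hit _  with any? (λ i → f i ≟ v)
  hit () | yes _
  hit _  | no ¬p = ¬p (i , eq)

length-++-< : ∀ (ys : List A) {as bs} → length as < length bs → length (ys ++ as) < length (ys ++ bs)
length-++-< []       lt = lt
length-++-< (_ ∷ ys) lt = s≤s (length-++-< ys lt)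

infixr 5 _⊕_

_⊕_ : List (Fin n) → Subset n → Subset n
[]       ⊕ B = B
(x ∷ xs) ⊕ B = ⁅ x ⁆ ∪ (xs ⊕ B)

∈⊕ˡ : ∀ {x} {xs : List (Fin n)} {B} → x ∈ˡ xs → x ∈ xs ⊕ B
∈⊕ˡ (here refl) = x∈p∪q⁺ (inj₁ (x∈⁅x⁆ _))
∈⊕ˡ (there p)   = x∈p∪q⁺ (inj₂ (∈⊕ˡ p))

∈⊕ʳ : ∀ {x} (xs : List (Fin n)) {B} → x ∈ B → x ∈ xs ⊕ B
∈⊕ʳ []       p = p
∈⊕ʳ (_ ∷ xs) p = x∈p∪q⁺ (inj₂ (∈⊕ʳ xs p))

∈⊕⁻ : ∀ {x} (xs : List (Fin n)) {B} → x ∈ xs ⊕ B → x ∈ˡ xs ⊎ x ∈ B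
∈⊕⁻ []       p = inj₂ p
∈⊕⁻ (y ∷ xs) p with x∈p∪q⁻ ⁅ y ⁆ _ p
... | inj₁ q = inj₁ (here (x∈⁅y⁆⇒x≡y y q))
... | inj₂ q with ∈⊕⁻ xs q
...   | inj₁ r = inj₁ (there r)
...   | inj₂ r = inj₂ r

-- Counting neighbours inside a set.

module _ {n} (G : Graph n) where

  private
    V : Set
    V = Fin n

  -- An upper bound `k` on the number of neighbours of `v` in `D`, witnessed by a list so that
  -- bounds add up by concatenation.
  Covered : V → Subset n → ℕ → Set
  Covered v D k = ∃ λ L → length L ≤ k × (∀ {u} → u ∈ D → Adj G v u → u ∈ˡ L)

  covered-mono : ∀ {v D k l} → k ≤ l → Covered v D k → Covered v D l
  covered-mono k≤l (L , le , cov) = L , ≤-trans le k≤l , cov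

  covered-⊕ : ∀ {v D k} xs → Covered v D k → Covered v (xs ⊕ D) (length xs + k)
  covered-⊕ {v} {D} xs (L , le , cov) =
    xs ++ L , ≤-trans (≤-reflexive (length-++ xs)) (+-monoʳ-≤ (length xs) le) , cov′
    where
    cov′ : ∀ {u} → u ∈ xs ⊕ D → Adj G v u → u ∈ˡ xs ++ L
    cov′ p a with ∈⊕⁻ xs p
    ... | inj₁ q = ∈-++⁺ˡ q
    ... | inj₂ q = ∈-++⁺ʳ xs (cov q a)

  -- Otherwise all neighbours of `v` occur in `L ++ used`, which is shorter than the degree. Every
  -- use of the minimum degree goes through this lemma.
  escape : ∀ {v D k} → Covered v D k → ∀ used → k + length used < degree G v →
           ∃ λ u → Adj G v u × u ∉ D × u ∉ˡ used
  escape {v} {D} {k} (L , le , cov) used lt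
    with any? (λ u → adj? G v u ×-dec (¬? (u ∈? D) ×-dec ¬? (u ∈ˡ? used)))
  ... | yes found = found
  ... | no ¬found = contradiction (≤-trans lt degree≤) (<-irrefl refl)
    where
    nbrs : List V
    nbrs = filter (adj? G v) (Vec.toList (Vec.allFin n))
    nbr-adj : ∀ {u} → u ∈ˡ nbrs → Adj G v u
    nbr-adj p = proj₂ (∈-filter⁻ (adj? G v) {xs = Vec.toList (Vec.allFin n)} p)
    inside : ∀ {u} → u ∈ˡ nbrs → u ∈ˡ L ++ used
    inside {u} p with u ∈? D | u ∈ˡ? used
    ... | yes q | _     = ∈-++⁺ˡ (cov q (nbr-adj p))
    ... | no _  | yes q = ∈-++⁺ʳ L q
    ... | no ¬q | no ¬r = contradiction (u , nbr-adj p , ¬q , ¬r) ¬found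
    degree≤ : degree G v ≤ k + length used
    degree≤ = ≤-trans
      (unique-⊆⇒length-≤ (Unique.filter⁺ (adj? G v) (unique-tabulate id id)) inside)
      (≤-trans (≤-reflexive (length-++ L)) (+-monoˡ-≤ (length used) le))

  Sparse : Subset n → V → Set
  Sparse B v = ∀ {b c} → b ∈ B → c ∈ B → Adj G v b → Adj G v c → b ≡ c

  Attached : Subset n → V → Set
  Attached B v = ∃₂ λ b c → b ∈ B × c ∈ B × b ≢ c × Adj G v b × Adj G v c

  sparse⊎attached : ∀ B v → Sparse B v ⊎ Attached B v
  sparse⊎attached B v
    with any? (λ b → any? (λ c →
           (b ∈? B) ×-dec ((c ∈? B) ×-dec (¬? (b ≟ c) ×-dec (adj? G v b ×-dec adj? G v c)))))
  ... | yes att = inj₂ att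
  ... | no ¬att = inj₁ λ {b} {c} b∈ c∈ vb vc → sparse b∈ c∈ vb vc (b ≟ c)
    where
    sparse : ∀ {b c} → b ∈ B → c ∈ B → Adj G v b → Adj G v c → Dec (b ≡ c) → b ≡ c
    sparse _  _  _  _  (yes eq) = eq
    sparse b∈ c∈ vb vc (no neq) = contradiction (_ , _ , b∈ , c∈ , neq , vb , vc) ¬att

  neighbour? : ∀ B v → Dec (∃ λ b → b ∈ B × Adj G v b)
  neighbour? B v = any? (λ b → (b ∈? B) ×-dec adj? G v b)

  sparse⇒covered : ∀ {B v} → Sparse B v → Covered v B 1
  sparse⇒covered {B} {v} sp with neighbour? B v
  ... | yes (b , b∈ , vb) = [ b ] , ≤-refl , λ c∈ vc → here (sp c∈ b∈ vc vb)
  ... | no ¬nb            = [] , z≤n , λ c∈ vc → contradiction (_ , c∈ , vc) ¬nb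

  -- Walks and chains.

  walk-source : ∀ {S u v} → WalkIn G S u v → u ∈ S
  walk-source (stay p)     = p
  walk-source (step p _ _) = p

  walk-trans : ∀ {S u v w} → WalkIn G S u v → WalkIn G S v w → WalkIn G S u w
  walk-trans (stay _)     q = q
  walk-trans (step p a w) q = step p a (walk-trans w q)

  walk-sym : ∀ {S u v} → WalkIn G S u v → WalkIn G S v u
  walk-sym (stay p)     = stay p
  walk-sym (step p a w) = walk-trans (walk-sym w) (step (walk-source w) (Graph.sym G a) (stay p))

  walk-mono : ∀ {S S′ u v} → S ⊆ S′ → WalkIn G S u v → WalkIn G S′ u v
  walk-mono sub (stay p)     = stay (sub p)
  walk-mono sub (step p a w) = step (sub p) a (walk-mono sub w)

  -- A walk from `a` to `b` in which only the interior is listed, because the ends of an ear lie in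
  -- `B` and its interior does not. Repetitions are allowed.
  Chain : V → List V → V → Set
  Chain a []       b = Adj G a b
  Chain a (x ∷ xs) b = Adj G a x × Chain x xs b

  chain-split : ∀ {a b p zs} ys → Chain a (ys ++ p ∷ zs) b → Chain a ys p × Chain p zs b
  chain-split []       (e , c) = e , c
  chain-split (_ ∷ ys) (e , c) = let l , r = chain-split ys c in (e , l) , r

  chain-join : ∀ {a b p zs} ys → Chain a ys p → Chain p zs b → Chain a (ys ++ p ∷ zs) b
  chain-join []       e       d = e , d
  chain-join (_ ∷ ys) (e , c) d = e , chain-join ys c d

  chain-walk : ∀ {S a b} xs → Chain a xs b → a ∈ S → All (_∈ S) xs → b ∈ S → WalkIn G S a b
  chain-walk []       e       a∈ _         b∈ = step a∈ e (stay b∈)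
  chain-walk (_ ∷ xs) (e , c) a∈ (p ∷ ps) b∈ = step a∈ e (chain-walk xs c p ps b∈)

  crossing-edge : ∀ {S B u v} → WalkIn G S u v → u ∈ B → v ∉ B →
                  ∃₂ λ b p → b ∈ B × p ∉ B × Adj G b p
  crossing-edge (stay _) u∈ v∉ = contradiction u∈ v∉
  crossing-edge {B = B} (step {v = w} _ a walk) u∈ v∉ with w ∈? B
  ... | yes w∈ = crossing-edge walk w∈ v∉
  ... | no  w∉ = _ , _ , u∈ , w∉ , a

  -- The walk is cut at its first vertex in `B`. Membership of that vertex in `S` is kept because
  -- `ear-exists` takes for `S` all vertices but the start of the ear, which makes the two ends
  -- differ.
  first-entry : ∀ {S B u v} → WalkIn G S u v → u ∉ B → v ∈ B →
                ∃₂ λ xs c → Chain u xs c × All (_∉ B) xs × c ∈ B × c ∈ S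
  first-entry (stay _) u∉ v∈ = contradiction v∈ u∉
  first-entry {B = B} (step {v = w} _ a walk) u∉ v∈ with w ∈? B
  ... | yes w∈ = [] , w , a , [] , w∈ , walk-source walk
  ... | no  w∉ = let xs , c , ch , out , c∈B , c∈S = first-entry walk w∉ v∈
                 in w ∷ xs , c , (a , ch) , w∉ ∷ out , c∈B , c∈S

  -- Ears over a robust core.

  -- Two-connectedness without the size condition, so that a single edge qualifies.
  record Robust (B : Subset n) : Set where
    field
      connected : ConnectedOn G B
      minus     : ∀ x → ConnectedOn G (B ─ ⁅ x ⁆)
      two       : ∃₂ λ b c → b ∈ B × c ∈ B × b ≢ c

  -- Repeated vertices are tolerated, so that walks and detours need no cleaning; `shortest-ear`
  -- removes them. The field `inner` guarantees that adding an ear enlarges `B`.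
  record Ear (B : Subset n) (xs : List V) : Set where
    field
      {start end} : V
      start∈      : start ∈ B
      end∈        : end ∈ B
      start≢end   : start ≢ end
      outer       : All (_∉ B) xs
      inner       : ∃ (_∈ˡ xs)
      chain       : Chain start xs end

  attached⇒ear : ∀ {B v} → v ∉ B → Attached B v → Ear B [ v ]
  attached⇒ear v∉ (b , c , b∈ , c∈ , b≢c , vb , vc) = record
    { start∈ = b∈ ; end∈ = c∈ ; start≢end = b≢c ; outer = v∉ ∷ []
    ; inner = _ , here refl ; chain = Graph.sym G vb , vc }

  module _ {B : Subset n} {xs : List V} (robust : Robust B) (ear : Ear B xs) where

    open Robust robust
    open Ear ear

    private
      -- Two vertices of `C` are joined through the core: each reaches a vertex of `B` inside `C`,
      -- and those are joined by `core`. It serves both for `xs ⊕ B` and for that set with one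
      -- vertex deleted.
      attach-connected : ∀ C → C ⊆ xs ⊕ B →
        (∀ b c → b ∈ B → b ∈ C → c ∈ B → c ∈ C → WalkIn G C b c) →
        (∀ ys y zs → xs ≡ ys ++ y ∷ zs → y ∈ C → ∃ λ b → b ∈ B × WalkIn G C y b) →
        ConnectedOn G C
      attach-connected C sub core reach u v u∈ v∈ =
        let b , b∈ , ub = toCore u u∈
            c , c∈ , vc = toCore v v∈
        in walk-trans ub (walk-trans
             (core b c b∈ (walk-source (walk-sym ub)) c∈ (walk-source (walk-sym vc))) (walk-sym vc))
        where
        toCore : ∀ u → u ∈ C → ∃ λ b → b ∈ B × WalkIn G C u b
        toCore u u∈ with ∈⊕⁻ xs (sub u∈)
        ... | inj₂ u∈B = u , u∈B , stay u∈
        ... | inj₁ u∈xs with ∈-∃++ u∈xs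
        ...   | ys , zs , eq = reach ys u zs eq u∈

    -- After the deletion of `x`, a vertex `y` of the ear goes back to `start` if `x` is neither
    -- `start` nor before `y`, and otherwise forward to `end`. As the ear has no repetition, `x`
    -- does not recur after `y`. Within the core, `minus x` applies even when `x` lies on the ear.
    ear-robust : Unique xs → Robust (xs ⊕ B)
    ear-robust uniq = record
      { connected = attach-connected (xs ⊕ B) id
          (λ b c b∈ _ c∈ _ → walk-mono (∈⊕ʳ xs) (connected b c b∈ c∈)) reach
      ; minus = λ x → attach-connected ((xs ⊕ B) - x) (p─q⊆p (xs ⊕ B) ⁅ x ⁆)
          (λ b c b∈ b∈C c∈ c∈C → walk-mono (λ {z} z∈ → keep (∈⊕ʳ xs (p─q⊆p B ⁅ x ⁆ z∈)) (≢x z∈))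
            (minus x b c (x∈p∧x≢y⇒x∈p-y b∈ (≢x b∈C)) (x∈p∧x≢y⇒x∈p-y c∈ (≢x c∈C))))
          (reach-minus x)
      ; two = let b , c , b∈ , c∈ , b≢c = two in b , c , ∈⊕ʳ xs b∈ , ∈⊕ʳ xs c∈ , b≢c
      }
      where
      ≢x : ∀ {S : Subset n} {x z} → z ∈ S - x → z ≢ x
      ≢x {S} {x} z∈ refl = x∉p-x S x z∈
      keep : ∀ {x z} → z ∈ xs ⊕ B → z ≢ x → z ∈ (xs ⊕ B) - x
      keep = x∈p∧x≢y⇒x∈p-y
      reach : ∀ ys y zs → xs ≡ ys ++ y ∷ zs → y ∈ xs ⊕ B → ∃ λ b → b ∈ B × WalkIn G (xs ⊕ B) y b
      reach ys y zs refl y∈ = start , start∈ , walk-sym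
        (chain-walk ys (proj₁ (chain-split ys chain)) (∈⊕ʳ xs start∈)
          (All.tabulate (λ p → ∈⊕ˡ (∈-++⁺ˡ p))) y∈)
      reach-minus : ∀ x ys y zs → xs ≡ ys ++ y ∷ zs → y ∈ (xs ⊕ B) - x →
                    ∃ λ b → b ∈ B × WalkIn G ((xs ⊕ B) - x) y b
      reach-minus x ys y zs refl y∈ with x ∈ˡ? (start ∷ ys)
      ... | no x∉ = start , start∈ , walk-sym
        (chain-walk ys (proj₁ (chain-split ys chain))
          (keep (∈⊕ʳ xs start∈) (λ eq → x∉ (here (≡-sym eq))))
          (All.tabulate (λ p → keep (∈⊕ˡ (∈-++⁺ˡ p)) λ { refl → x∉ (there p) })) y∈)
      ... | yes x∈ = end , end∈ ,
        chain-walk zs (proj₂ (chain-split ys chain)) y∈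
          (All.tabulate (λ p → keep (∈⊕ˡ (∈-++⁺ʳ ys (there p))) (zs-clear x∈ p)))
          (keep (∈⊕ʳ xs end∈) (end-clear x∈))
        where
        zs-clear : ∀ {z} → x ∈ˡ start ∷ ys → z ∈ˡ zs → z ≢ x
        zs-clear (here refl) p refl = All.lookup outer (∈-++⁺ʳ ys (there p)) start∈
        zs-clear (there q)   p refl = unique-++-disjoint ys uniq q (there p)
        end-clear : x ∈ˡ start ∷ ys → end ≢ x
        end-clear (here refl) refl = start≢end refl
        end-clear (there q)   refl = All.lookup outer (∈-++⁺ˡ q) end∈

  edge-robust : ∀ {x y} → Adj G x y → Robust ((x ∷ y ∷ []) ⊕ ⊥)
  edge-robust {x} {y} a = record
    { connected = λ u v u∈ v∈ → join u∈ v∈ (ends u∈) (ends v∈)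
    ; minus     = λ z u v u∈ v∈ → join u∈ v∈ (ends (p─q⊆p _ ⁅ z ⁆ u∈)) (ends (p─q⊆p _ ⁅ z ⁆ v∈))
    ; two       = x , y , ∈⊕ˡ {xs = x ∷ y ∷ []} (here refl) , ∈⊕ˡ {xs = x ∷ y ∷ []} (there (here refl)) ,
                  λ { refl → Graph.irrefl G a }
    }
    where
    ends : ∀ {u} → u ∈ (x ∷ y ∷ []) ⊕ ⊥ → u ≡ x ⊎ u ≡ y
    ends u∈ with ∈⊕⁻ (x ∷ y ∷ []) u∈
    ... | inj₁ (here eq)         = inj₁ eq
    ... | inj₁ (there (here eq)) = inj₂ eq
    ... | inj₂ u∈⊥               = contradiction u∈⊥ ∉⊥
    join : ∀ {C u v} → u ∈ C → v ∈ C → u ≡ x ⊎ u ≡ y → v ≡ x ⊎ v ≡ y → WalkIn G C u v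
    join u∈ v∈ (inj₁ refl) (inj₁ refl) = stay u∈
    join u∈ v∈ (inj₁ refl) (inj₂ refl) = step u∈ a (stay v∈)
    join u∈ v∈ (inj₂ refl) (inj₁ refl) = step u∈ (Graph.sym G a) (stay v∈)
    join u∈ v∈ (inj₂ refl) (inj₂ refl) = stay u∈

  -- Some edge leaves `B`, from `a` to `p`. Since `G` without `a` is connected, `p` has a walk
  -- avoiding `a` to another vertex `d` of `B`; its part up to the first entry into `B` completes
  -- the ear.
  ear-exists : TwoConnected G → ∀ {B u} → Robust B → u ∉ B → ∃ (Ear B)
  ear-exists (_ , conn , minus) {B} {u} robust u∉ =
    let b , c , b∈ , c∈ , b≢c = Robust.two robust
        a , p , a∈ , p∉ , ap  = crossing-edge (conn b u everywhere everywhere) b∈ u∉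
        d , d∈ , d≢a          = other b c a b∈ c∈ b≢c
        xs , e , ch , out , e∈ , e∈S = first-entry
          (minus a everywhere p d (x∈p∧x≢y⇒x∈p-y everywhere λ eq → p∉ (subst (_∈ B) (≡-sym eq) a∈))
                                  (x∈p∧x≢y⇒x∈p-y everywhere d≢a)) p∉ d∈
    in p ∷ xs , record
      { start∈ = a∈ ; end∈ = e∈ ; start≢end = λ eq → x∉p-x full a (subst (_∈ full - a) (≡-sym eq) e∈S)
      ; outer = p∉ ∷ out ; inner = p , here refl ; chain = ap , ch }
    where
    everywhere : ∀ {n} {v : Fin n} → v ∈ full
    everywhere {v = fzero}  = Vec.here
    everywhere {v = fsuc v} = Vec.there everywhere
    other : ∀ b c a → b ∈ B → c ∈ B → b ≢ c → ∃ λ d → d ∈ B × d ≢ a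
    other b c a b∈ c∈ b≢c with b ≟ a
    ... | yes refl = c , c∈ , λ eq → b≢c (≡-sym eq)
    ... | no b≢a   = b , b∈ , b≢a

  -- Shortening ears when no outside vertex is attached.

  module _ {B : Subset n} (sparse : ∀ v → v ∉ B → Sparse B v) where

    Shorter : List V → Set
    Shorter xs = ∃ λ xs′ → Ear B xs′ × length xs′ < length xs

    private
      drop-repeat : ∀ {xs} → Ear B xs → ∀ ys x zs ws → xs ≡ ys ++ x ∷ zs ++ x ∷ ws → Shorter xs
      drop-repeat ear ys x zs ws refl =
        ys ++ x ∷ ws ,
        record
          { start∈ = start∈ ; end∈ = end∈ ; start≢end = start≢end
          ; outer = AllP.++⁺ (AllP.++⁻ˡ ys outer) (AllP.++⁻ʳ (x ∷ zs) (AllP.++⁻ʳ ys outer))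
          ; inner = x , ∈-++⁺ʳ ys (here refl)
          ; chain = let l , r = chain-split ys chain in chain-join ys l (proj₂ (chain-split zs r)) } ,
        length-++-< ys (s≤s (≤-trans (m≤n+m _ (length zs)) (≤-reflexive (≡-sym (length-++ zs)))))
        where open Ear ear

      -- The at least two vertices between the first and the fourth neighbour of `v` are replaced by
      -- `v` alone. It does no harm if `v` itself is on the ear.
      shortcut : ∀ {xs v} → Ear B xs → v ∉ B → 4 ≤ length (filter (adj? G v) xs) → Shorter xs
      shortcut {xs} {v} ear v∉ hits with far-hits (adj? G v) 2 xs hits
      ... | ys , p , zs , q , ws , refl , vp , vq , long =
        ys ++ p ∷ v ∷ q ∷ ws ,
        record
          { start∈ = start∈ ; end∈ = end∈ ; start≢end = start≢end
          ; outer = let l , r = AllP.++⁻ ys outer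
                    in AllP.++⁺ l (All.head r ∷ v∉ ∷ AllP.++⁻ʳ zs (All.tail r))
          ; inner = p , ∈-++⁺ʳ ys (here refl)
          ; chain = let l , r = chain-split ys chain
                    in chain-join ys l (Graph.sym G vp , vq , proj₂ (chain-split zs r)) } ,
        length-++-< ys (s≤s (≤-trans (+-monoˡ-≤ (suc (length ws)) long) (≤-reflexive (≡-sym (length-++ zs)))))
        where open Ear ear

      -- With `b` as a new end, three neighbours on the ear suffice. If `b` is not `start`, the ear
      -- leaves at `p` and ends through `v` at `b`; if it is, the ear begins with `v` and rejoins at
      -- `q`. Either way the two ends stay distinct.
      shortcut-to-core : ∀ {xs v b} → Ear B xs → v ∉ B → b ∈ B → Adj G v b →
                         3 ≤ length (filter (adj? G v) xs) → Shorter xs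
      shortcut-to-core {xs} {v} {b} ear v∉ b∈ vb hits with far-hits (adj? G v) 1 xs hits
      ... | ys , p , zs , q , ws , refl , vp , vq , long with b ≟ Ear.start ear
      ...   | no b≢start =
        ys ++ p ∷ v ∷ [] ,
        record
          { start∈ = start∈ ; end∈ = b∈ ; start≢end = λ eq → b≢start (≡-sym eq)
          ; outer = let l , r = AllP.++⁻ ys outer in AllP.++⁺ l (All.head r ∷ v∉ ∷ [])
          ; inner = p , ∈-++⁺ʳ ys (here refl)
          ; chain = chain-join ys (proj₁ (chain-split ys chain)) (Graph.sym G vp , vb) } ,
        length-++-< ys (s≤s (≤-trans (+-mono-≤ long (s≤s z≤n)) (≤-reflexive (≡-sym (length-++ zs)))))
        where open Ear ear
      ...   | yes refl =
        v ∷ q ∷ ws ,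
        record
          { start∈ = b∈ ; end∈ = end∈ ; start≢end = start≢end
          ; outer = v∉ ∷ AllP.++⁻ʳ zs (All.tail (AllP.++⁻ʳ ys outer))
          ; inner = v , here refl
          ; chain = Graph.sym G vb , vq , proj₂ (chain-split zs (proj₂ (chain-split ys chain))) } ,
        ≤-trans (s≤s (≤-trans (+-monoˡ-≤ (suc (length ws)) long) (≤-reflexive (≡-sym (length-++ zs)))))
          (≤-trans (m≤n+m _ (length ys)) (≤-reflexive (≡-sym (length-++ ys))))
        where open Ear ear

    -- The bound 3 is one neighbour in `B` and at most two on the ear, or none in `B` and at most
    -- three on the ear.
    covered⊎shorter : ∀ {xs} → Ear B xs → ∀ v → (v ∉ B → Covered v (xs ⊕ B) 3) ⊎ Shorter xs
    covered⊎shorter {xs} ear v with v ∈? B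
    ... | yes v∈ = inj₁ λ v∉ → contradiction v∈ v∉
    ... | no v∉ with neighbour? B v
    ...   | yes (b , b∈ , vb) with 3 ≤? length (filter (adj? G v) xs)
    ...     | yes hits = inj₂ (shortcut-to-core ear v∉ b∈ vb hits)
    ...     | no ¬hits = inj₁ λ _ → b ∷ filter (adj? G v) xs , ≰⇒> ¬hits , cov
      where
      cov : ∀ {u} → u ∈ xs ⊕ B → Adj G v u → u ∈ˡ b ∷ filter (adj? G v) xs
      cov u∈ vu with ∈⊕⁻ xs u∈
      ... | inj₁ p = there (∈-filter⁺ (adj? G v) p vu)
      ... | inj₂ p = here (sparse v v∉ p b∈ vu vb)
    covered⊎shorter {xs} ear v | no v∉ | no ¬nb with 4 ≤? length (filter (adj? G v) xs)
    ... | yes hits = inj₂ (shortcut ear v∉ hits)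
    ... | no ¬hits = inj₁ λ _ → filter (adj? G v) xs , ≤-pred (≰⇒> ¬hits) , cov
      where
      cov : ∀ {u} → u ∈ xs ⊕ B → Adj G v u → u ∈ˡ filter (adj? G v) xs
      cov u∈ vu with ∈⊕⁻ xs u∈
      ... | inj₁ p = ∈-filter⁺ (adj? G v) p vu
      ... | inj₂ p = contradiction (_ , p , vu) ¬nb

    -- It is enough that none of the shortenings above applies any more; `k` bounds how many can be
    -- made.
    shortest-ear : ∀ k xs → length xs ≤ k → Ear B xs →
      ∃ λ xs′ → Ear B xs′ × Unique xs′ × (∀ v → v ∉ B → Covered v (xs′ ⊕ B) 3)
    shortest-ear zero    []      _  ear with Ear.inner ear
    ... | _ , ()
    shortest-ear (suc k) xs le ear with unique⊎repeat xs
    ... | inj₂ (ys , x , zs , ws , eq) =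
      let xs′ , ear′ , lt = drop-repeat ear ys x zs ws eq
      in shortest-ear k xs′ (≤-pred (≤-trans lt le)) ear′
    ... | inj₁ uniq with ∀⊎∃ (covered⊎shorter ear)
    ...   | inj₁ cov = xs , ear , uniq , cov
    ...   | inj₂ (_ , xs′ , ear′ , lt) = shortest-ear k xs′ (≤-pred (≤-trans lt le)) ear′

  -- Paths and copies of the path-star avoiding a set.

  record Path (D : Subset n) (xs : List V) : Set where
    field
      linked   : Linked (Adj G) xs
      distinct : Unique xs
      avoids   : All (_∉ D) xs

  path-take : ∀ {D xs} k → Path D xs → Path D (take k xs)
  path-take k p = record
    { linked = linked-take k linked ; distinct = Unique.take⁺ k distinct ; avoids = AllP.take⁺ k avoids }
    where open Path p

  path-∷ : ∀ {D x y xs} → Adj G x y → x ∉ D → x ∉ˡ xs → Path D (y ∷ xs) → Path D (x ∷ y ∷ xs)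
  path-∷ a x∉D x∉xs p = record
    { linked   = a ∷ linked
    ; distinct = ((λ { refl → Graph.irrefl G a }) ∷ ∉⇒All≢ x∉xs) ∷ distinct
    ; avoids   = x∉D ∷ avoids }
    where open Path p

  path-⊕ : ∀ {D xs a} → a ∉ˡ xs → Path D xs → Path ([ a ] ⊕ D) xs
  path-⊕ {D} {xs} {a} a∉ p = record
    { linked = linked ; distinct = distinct
    ; avoids = All.tabulate λ z∈ z∈D → [ (λ { (here refl) → a∉ z∈ }) , All.lookup avoids z∈ ]′ (∈⊕⁻ [ a ] z∈D) }
    where open Path p

  -- The path-star graph with r and m = r + 3 + ℓ; the spine starts at the centre.
  module _ (r ℓ : ℕ) where

    -- In `vertices`, counting from the end gives the numbering of the path-star: `spine` occupies
    -- `0` to `r`, its last vertex being `0`, `centre` is `r + 1`, and the `ℓ + 1` remaining leaves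
    -- come after. One of them is singled out as `leaf` to prolong the path.
    record Copy (D : Subset n) : Set where
      field
        leaf centre  : V
        leaves spine : List V
        ∣leaves∣     : length leaves ≡ ℓ
        ∣spine∣      : length spine ≡ suc r
        star         : All (Adj G centre) (leaf ∷ leaves)
        linked       : Linked (Adj G) (centre ∷ spine)
        distinct     : Unique (leaf ∷ leaves ++ centre ∷ spine)
        avoids       : All (_∉ D) (leaf ∷ leaves ++ centre ∷ spine)
      vertices : List V
      vertices = leaf ∷ leaves ++ centre ∷ spine

      ∣vertices∣ : length vertices ≡ r + 3 + ℓ
      ∣vertices∣ rewrite length-++ leaves {centre ∷ spine} | ∣leaves∣ | ∣spine∣ = arith r ℓ
        where
        arith : ∀ r ℓ → suc (ℓ + suc (suc r)) ≡ r + 3 + ℓ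
        arith = solve-∀

    module _ {D : Subset n} (T : Copy D) where

      open Copy T

      embed-at : ∀ i → ∃ (At vertices (toℕ {r + 3 + ℓ} i))
      embed-at i = at-total vertices (≤-trans (toℕ<n i) (≤-reflexive (≡-sym ∣vertices∣)))

      embed : Fin (r + 3 + ℓ) → V
      embed i = proj₁ (embed-at i)

      embed-∈ : ∀ i → embed i ∈ˡ vertices
      embed-∈ i = at-∈ (proj₂ (embed-at i))

      ∈-embed : ∀ {v} → v ∈ˡ vertices → ∃ λ i → embed i ≡ v
      ∈-embed p with ∈-at p
      ... | k , at = fromℕ< k< , at-functional
              (subst (λ j → At vertices j (embed (fromℕ< k<))) (toℕ-fromℕ< k<) (proj₂ (embed-at (fromℕ< k<)))) at
        where
        k< : k < r + 3 + ℓ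
        k< = ≤-trans (at-< at) (≤-reflexive ∣vertices∣)

      embed-isEmbedding : IsPSEmbedding G r (r + 3 + ℓ) embed
      embed-isEmbedding = injective , edge
        where
        injective : ∀ {i j} → embed i ≡ embed j → i ≡ j
        injective {i} {j} eq = toℕ-injective
          (at-injective distinct (proj₂ (embed-at i))
            (subst (At vertices (toℕ j)) (≡-sym eq) (proj₂ (embed-at j))))
        on-path : ∀ {k x} → k ≤ suc r → At vertices k x → At (centre ∷ spine) k x
        on-path le at = at-++ʳ⁻ (leaf ∷ leaves) at (s≤s (≤-trans le (≤-reflexive (≡-sym ∣spine∣))))
        directed : ∀ {i j x y} → PSEdge→ r (r + 3 + ℓ) i j → At vertices i x → At vertices j y → Adj G x y
        directed (inj₁ (refl , j≤)) p q =
          Graph.sym G (at-linked linked (on-path j≤ q) (on-path (≤-trans (n≤1+n _) j≤) p))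
        directed {x = x} {y} (inj₂ (refl , ≤j , _)) p q =
          subst (λ c → Adj G c y)
            (at-functional (subst (λ k → At (centre ∷ spine) k centre) ∣spine∣ head) (on-path ≤-refl p))
            (All.lookup star
              (at-++ˡ (leaf ∷ leaves) q (≤-trans (≤-reflexive (cong suc ∣spine∣)) ≤j)))
        edge : ∀ i j → PSEdge r (r + 3 + ℓ) i j → Adj G (embed i) (embed j)
        edge i j (inj₁ e) = directed e (proj₂ (embed-at i)) (proj₂ (embed-at j))
        edge i j (inj₂ e) = Graph.sym G (directed e (proj₂ (embed-at j)) (proj₂ (embed-at i)))

    -- Greedy construction of copies.

    module _ (large : ∀ v → 5 + (r + ℓ) ≤ degree G v) where

      -- When a leaf is added, at most `3` neighbours of `c` in `D`, `ℓ` earlier leaves and `r + 1`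
      -- path vertices are excluded, which is exactly one less than the guaranteed degree.
      attach-leaves : ∀ {D c ps} → Covered c D 3 → Path D (c ∷ ps) → length ps ≡ suc r →
        ∀ j → j ≤ suc ℓ → ∃ λ ls → length ls ≡ j × All (Adj G c) ls ×
          Unique (ls ++ c ∷ ps) × All (_∉ D) (ls ++ c ∷ ps)
      attach-leaves cov p eq zero _ = [] , refl , [] , Path.distinct p , Path.avoids p
      attach-leaves {D} {c} {ps} cov p eq (suc j) (s≤s j≤ℓ)
        with attach-leaves cov p eq j (≤-trans j≤ℓ (n≤1+n ℓ))
      ... | ls , refl , adj , uniq , out
        with escape cov (ls ++ ps) (≤-trans (s≤s bound) (large c))
        where
        arith : ∀ r ℓ → 3 + (ℓ + suc r) ≡ 4 + (r + ℓ)
        arith = solve-∀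
        bound : 3 + length (ls ++ ps) ≤ 4 + (r + ℓ)
        bound rewrite length-++ ls {ps} | eq =
          ≤-trans (+-monoʳ-≤ 3 (+-monoˡ-≤ (suc r) j≤ℓ)) (≤-reflexive (arith r ℓ))
      ... | y , cy , y∉D , y∉ =
        y ∷ ls , refl , cy ∷ adj , ∉⇒All≢ fresh ∷ uniq , y∉D ∷ out
        where
        fresh : y ∉ˡ ls ++ c ∷ ps
        fresh q with ∈-++⁻ ls q
        ... | inj₁ q′          = y∉ (∈-++⁺ˡ q′)
        ... | inj₂ (here refl) = Graph.irrefl G cy
        ... | inj₂ (there q′)  = y∉ (∈-++⁺ʳ ls q′)

      -- Only the head of the path, which becomes the centre, has to have few neighbours in `D`.
      path⇒copy : ∀ {D c ps} → Covered c D 3 → Path D (c ∷ ps) → length ps ≡ suc r → Copy D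
      path⇒copy cov p eq with attach-leaves cov p eq (suc ℓ) ≤-refl
      ... | l ∷ ls , ∣ls∣ , adj , uniq , out = record
        { leaf = l ; leaves = ls ; ∣leaves∣ = suc-injective ∣ls∣ ; ∣spine∣ = eq
        ; star = adj ; linked = Path.linked p ; distinct = uniq ; avoids = out }

      greedy-path : ∀ {D v} → (∀ v → v ∉ D → Covered v D 3) → v ∉ D → ∀ j → j ≤ suc r →
                    ∃₂ λ c ps → length ps ≡ j × Path D (c ∷ ps)
      greedy-path {v = v} cov v∉ zero _ =
        v , [] , refl , record { linked = [-] ; distinct = [] ∷ [] ; avoids = v∉ ∷ [] }
      greedy-path cov v∉ (suc j) (s≤s j≤r) with greedy-path cov v∉ j (≤-trans j≤r (n≤1+n r))
      ... | c , ps , refl , p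
        with escape (cov c (All.head (Path.avoids p))) ps
               (≤-trans (+-monoʳ-≤ 4 (≤-trans j≤r (m≤m+n r ℓ))) (≤-trans (n≤1+n _) (large c)))
      ... | y , cy , y∉D , y∉ = y , c ∷ ps , refl , path-∷ (Graph.sym G cy) y∉D y∉ p

      greedy-copy : ∀ {D v} → (∀ v → v ∉ D → Covered v D 3) → v ∉ D → Copy D
      greedy-copy cov v∉ = let c , ps , eq , p = greedy-path cov v∉ (suc r) ≤-refl
                           in path⇒copy (cov c (All.head (Path.avoids p))) p eq

      -- Adding an attached vertex to the core.

      module _ {B : Subset n} (T : Copy B) where

        open Copy T

        private
          long : List V
          long = leaf ∷ centre ∷ spine

          long⊆ : ∀ {z} → z ∈ˡ long → z ∈ˡ vertices
          long⊆ (here eq) = here eq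
          long⊆ (there p) = there (∈-++⁺ʳ leaves p)

          long-unique : Unique long
          long-unique with distinct
          ... | f ∷ u = AllP.++⁻ʳ leaves f ∷ unique-++ʳ leaves u

          long-linked : Linked (Adj G) long
          long-linked = Graph.sym G (All.head star) ∷ linked

        -- If the path cannot be extended off T, its end has so many neighbours on T that it can
        -- enter the path leaf, centre, spine at one of its first vertices and follow it to the end.
        path-outside : (∀ v → v ∉ B → v ∉ˡ vertices → Sparse B v) →
          ∀ k u vis → u ∉ B → u ∉ˡ vertices → All (_∉ˡ vertices) vis → length vis + k ≡ suc r →
          ∃ λ ys → length ys ≡ k × Path B (u ∷ ys) × (∀ {y} → y ∈ˡ ys → y ∉ˡ vis)
        path-outside sp zero u vis u∉B u∉T vis∉T _ =
          [] , refl , record { linked = [-] ; distinct = [] ∷ [] ; avoids = u∉B ∷ [] } , λ ()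
        path-outside sp (suc k) u vis u∉B u∉T vis∉T eq
          -- `bs` consists of the last `k` vertices of `long`, so a path entering `long` within `as`
          -- has at least `k` vertices still to come.
          with split-suffix k long
                 (≤-trans (≤-trans (m≤n+m k (suc (length vis)))
                                   (≤-reflexive (trans (≡-sym (+-suc (length vis) k)) eq)))
                          (≤-trans (≤-reflexive (≡-sym ∣spine∣)) (≤-trans (n≤1+n _) (n≤1+n _))))
        ... | as , bs , split , ∣bs∣
          -- Excluded are the `r - k` visited vertices, the `ℓ` leaves not on `long`, and the `k`
          -- vertices of `bs`, in all `r + ℓ`, besides at most one neighbour in `B`. A neighbour
          -- found on `T` must then lie in `as`.
          with escape (sparse⇒covered (sp u u∉B u∉T)) (vis ++ leaves ++ bs)
                 (≤-trans (s≤s (s≤s (≤-reflexive used))) (≤-trans (+-monoˡ-≤ (r + ℓ) two≤) (large u)))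
          where
          two≤ : 2 ≤ 5
          two≤ = s≤s (s≤s z≤n)
          arith : ∀ a b c → a + (b + c) ≡ (a + c) + b
          arith = solve-∀
          used : length (vis ++ leaves ++ bs) ≡ r + ℓ
          used rewrite length-++ vis {leaves ++ bs} | length-++ leaves {bs} | ∣leaves∣ | ∣bs∣ =
            trans (arith (length vis) ℓ k)
              (cong (_+ ℓ) (suc-injective (trans (≡-sym (+-suc (length vis) k)) eq)))
        ... | y , uy , y∉B , y∉ with y ∈ˡ? vertices
        ...   | no y∉T
          with path-outside sp k y (u ∷ vis) y∉B y∉T (u∉T ∷ vis∉T) (trans (≡-sym (+-suc (length vis) k)) eq)
        ...     | ys , refl , p , ys∉ =
          y ∷ ys , refl , path-∷ uy u∉B (λ q → ys∉ q (here refl)) p ,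
          λ { (here refl) q → y∉ (∈-++⁺ˡ q) ; (there z) q → ys∉ z (there q) }
        path-outside sp (suc k) u vis u∉B u∉T vis∉T eq
          | as , bs , split , ∣bs∣ | y , uy , y∉B , y∉ | yes y∈T with ∈-∃++ y∈as
          where
          y∈long : y ∈ˡ vertices → y ∈ˡ long
          y∈long (here eq) = here eq
          y∈long (there p) with ∈-++⁻ leaves p
          ... | inj₁ q = contradiction (∈-++⁺ʳ vis (∈-++⁺ˡ q)) y∉
          ... | inj₂ q = there q
          y∈as : y ∈ˡ as
          y∈as with ∈-++⁻ as (subst (y ∈ˡ_) split (y∈long y∈T))
          ... | inj₁ q = q
          ... | inj₂ q = contradiction (∈-++⁺ʳ vis (∈-++⁺ʳ leaves q)) y∉
        ... | a₁ , a₂ , refl =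
          take (suc k) (y ∷ a₂ ++ bs) , cong suc (length-take-≤ k (a₂ ++ bs) enough) ,
          path-∷ uy u∉B (λ q → u∉T (rest⊆ (there (take-⊆ k q)))) (path-take (suc k) rest-path) ,
          λ q z → All.lookup vis∉T z (rest⊆ (take-⊆ (suc k) q))
          where
          split′ : long ≡ a₁ ++ y ∷ a₂ ++ bs
          split′ = trans split (++-assoc a₁ (y ∷ a₂) bs)
          rest⊆ : ∀ {z} → z ∈ˡ y ∷ a₂ ++ bs → z ∈ˡ vertices
          rest⊆ q = long⊆ (subst (_ ∈ˡ_) (≡-sym split′) (∈-++⁺ʳ a₁ q))
          rest-path : Path B (y ∷ a₂ ++ bs)
          rest-path = record
            { linked   = linked-++ʳ a₁ (subst (Linked (Adj G)) split′ long-linked)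
            ; distinct = unique-++ʳ a₁ (subst Unique split′ long-unique)
            ; avoids   = All.tabulate λ q → All.lookup avoids (rest⊆ q) }
          enough : k ≤ length (a₂ ++ bs)
          enough = ≤-trans (≤-reflexive (≡-sym ∣bs∣))
            (≤-trans (m≤n+m _ (length a₂)) (≤-reflexive (≡-sym (length-++ a₂))))

      Augmentation : Subset n → Set
      Augmentation B = ∃ λ a → a ∉ B × Attached B a × Copy ([ a ] ⊕ B)

      augment-off-path : ∀ {B a u us} → a ∉ B → Attached B a → a ∉ˡ u ∷ us → Sparse B u →
                         length us ≡ suc r → Path B (u ∷ us) → Augmentation B
      augment-off-path {B} {a} {u} a∉B att a∉ sp eq p =
        a , a∉B , att ,
        path⇒copy (covered-mono (s≤s (s≤s z≤n)) (covered-⊕ [ a ] (sparse⇒covered sp))) (path-⊕ a∉ p) eq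

      -- Extending the path at its head and dropping its last vertex eventually pushes a off the path.
      slide : ∀ {B a} → a ∉ B → Attached B a → ∀ k j u us → k + j ≡ suc (suc r) → length us ≡ suc r →
              Path B (u ∷ us) → Sparse B u → a ∉ˡ take j (u ∷ us) → Augmentation B
      slide {a = a} a∉B att zero j u us refl eq p sp a∉ =
        augment-off-path a∉B att (subst (a ∉ˡ_) (take-all j (u ∷ us) (s≤s (≤-reflexive eq))) a∉) sp eq p
      slide {B} {a} a∉B att (suc k) j u us kj eq p sp a∉
        -- Excluding `a` ensures that it is never prepended and can only move towards the dropped
        -- end. If the new vertex `y` is attached, the present path misses it and `y` takes the
        -- place of `a`.
        with escape (sparse⇒covered sp) (a ∷ us) (≤-trans bound (large u))
        where
        bound : 3 + length us ≤ 5 + (r + ℓ)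
        bound rewrite eq = ≤-trans (+-monoʳ-≤ 4 (m≤m+n r ℓ)) (n≤1+n _)
      ... | y , uy , y∉B , y∉ with sparse⊎attached B y
      ...   | inj₂ att-y =
        augment-off-path y∉B att-y
          (λ { (here refl) → Graph.irrefl G uy ; (there q) → y∉ (there q) }) sp eq p
      ...   | inj₁ sp-y =
        slide a∉B att k (suc j) y (u ∷ take r us) (trans (+-suc k j) kj)
          (cong suc (length-take-≤ r us (≤-trans (n≤1+n r) (≤-reflexive (≡-sym eq)))))
          (path-∷ (Graph.sym G uy) y∉B (λ q → y∉ (there (take-⊆ r q))) (path-take (suc r) p))
          sp-y
          (λ { (here refl) → y∉ (here refl) ; (there q) → a∉ (take-take-⊆ j (suc r) q) })

      augment : ∀ {B a u} → a ∉ B → Attached B a → ∀ T → u ∉ B → u ∉ˡ Copy.vertices {B} T →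
                Augmentation B
      augment {B} {a} {u} a∉B att T u∉B u∉T with ∀⊎∃ outside-T
        where
        outside-T : ∀ v → (v ∉ B → v ∉ˡ Copy.vertices T → Sparse B v) ⊎
                          (v ∉ B × v ∉ˡ Copy.vertices T × Attached B v)
        outside-T v with v ∈? B | v ∈ˡ? Copy.vertices T | sparse⊎attached B v
        ... | yes p | _     | _      = inj₁ λ v∉ → contradiction p v∉
        ... | no _  | yes p | _      = inj₁ λ _ v∉ → contradiction p v∉
        ... | no p  | no q  | inj₂ t = inj₂ (p , q , t)
        ... | no _  | no _  | inj₁ s = inj₁ λ _ _ {_} {_} → s
      -- An attached vertex off `T` can be added to `B` while `T` itself is kept.
      ... | inj₂ (b , b∉B , b∉T , att-b) = b , b∉B , att-b , record
        { Copy T ; avoids = All.tabulate λ z∈ z∈D →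
            [ (λ { (here refl) → b∉T z∈ }) , All.lookup (Copy.avoids T) z∈ ]′ (∈⊕⁻ [ b ] z∈D) }
      ... | inj₁ sp with path-outside T sp (suc r) u [] u∉B u∉T [] refl
      -- With `j = 0` nothing is assumed about where `a` lies on the path.
      ...   | us , eq , p , _ = slide a∉B att (suc (suc r)) 0 u us (+-comm _ 0) eq p (sp u u∉B u∉T) λ ()

      -- Enlarging the core until core and copy span the graph.

      enlarge : TwoConnected G → ∀ {B u} → Robust B → ∀ T → u ∉ B → u ∉ˡ Copy.vertices {B} T →
                ∃ λ xs → Ear B xs × Robust (xs ⊕ B) × Copy (xs ⊕ B)
      enlarge two-conn {B} {u} robust T u∉B u∉T with ∀⊎∃ classify
        where
        classify : ∀ v → (v ∉ B → Sparse B v) ⊎ (v ∉ B × Attached B v)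
        classify v with v ∈? B | sparse⊎attached B v
        ... | yes p | _      = inj₁ λ v∉ → contradiction p v∉
        ... | no p  | inj₂ t = inj₂ (p , t)
        ... | no _  | inj₁ s = inj₁ λ _ {_} {_} → s
      ... | inj₂ (a , a∉B , att) with augment a∉B att T u∉B u∉T
      ...   | b , b∉B , att-b , T′ =
        let ear = attached⇒ear b∉B att-b in [ b ] , ear , ear-robust robust ear ([] ∷ []) , T′
      enlarge two-conn {B} {u} robust T u∉B u∉T | inj₁ sparse with ear-exists two-conn robust u∉B
      ... | xs , ear with shortest-ear sparse _ xs ≤-refl ear
      ...   | xs′ , ear′ , uniq , cov
        -- The greedy search needs a vertex off the core and the ear. Since `u` has at most three
        -- neighbours there, another neighbour of `u` serves, even if `u` is on the ear.
        with escape (cov u u∉B) [] (≤-trans (s≤s (s≤s (s≤s (s≤s z≤n)))) (large u))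
      ...     | v , _ , v∉ , _ =
        xs′ , ear′ , ear-robust robust ear′ uniq , greedy-copy (λ w w∉ → cov w (w∉ ∘ ∈⊕ʳ xs′)) v∉

      -- Each enlargement adds an inner vertex of an ear, so the complement of the core shrinks
      -- strictly; `k` bounds its size.
      maximal : TwoConnected G → ∀ k {B} → ∣ ∁ B ∣ ≤ k → Robust B → Copy B →
                ∃ λ B′ → Robust B′ × Σ (Copy B′) λ T → ∀ v → v ∉ B′ → v ∈ˡ Copy.vertices T
      maximal two-conn k {B} le robust T with ∀⊎∃ spanned
        where
        spanned : ∀ v → (v ∉ B → v ∈ˡ Copy.vertices T) ⊎ (v ∉ B × v ∉ˡ Copy.vertices T)
        spanned v with v ∈? B | v ∈ˡ? Copy.vertices T
        ... | yes p | _     = inj₁ λ v∉ → contradiction p v∉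
        ... | no _  | yes q = inj₁ λ _ → q
        ... | no p  | no q  = inj₂ (p , q)
      ... | inj₁ span = B , robust , T , span
      ... | inj₂ (u , u∉B , u∉T) with enlarge two-conn robust T u∉B u∉T
      ...   | xs , ear , robust′ , T′ = descend k le
        where
        x∈ : ∃ (_∈ˡ xs)
        x∈ = Ear.inner ear
        shrink : ∣ ∁ (xs ⊕ B) ∣ < ∣ ∁ B ∣
        shrink = p⊂q⇒∣p∣<∣q∣ (p⊂q⇒∁p⊃∁q
          (∈⊕ʳ xs , proj₁ x∈ , ∈⊕ˡ (proj₂ x∈) , All.lookup (Ear.outer ear) (proj₂ x∈)))
        descend : ∀ k → ∣ ∁ B ∣ ≤ k → _
        descend zero    le with ≤-trans shrink le
        ... | ()
        descend (suc k) le = maximal two-conn k (≤-pred (≤-trans shrink le)) robust′ T′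

      edge-and-copy : V → ∃ λ B → Robust B × Copy B
      edge-and-copy x =
        let y , xy , _     = escape (none x) [] (≤-trans (s≤s z≤n) (large x))
            xy-covered v   = covered-⊕ (x ∷ y ∷ []) (none v)
            z , _ , z∉ , _ = escape (xy-covered x) [] (≤-trans (s≤s (s≤s (s≤s z≤n))) (large x))
        in (x ∷ y ∷ []) ⊕ ⊥ , edge-robust xy ,
           greedy-copy (λ v _ → covered-mono (s≤s (s≤s z≤n)) (xy-covered v)) z∉
        where
        none : ∀ v → Covered v ⊥ 0
        none v = [] , z≤n , λ u∈ _ → contradiction u∈ ∉⊥

      -- As `T` avoids `B` and covers the rest, `B` is the complement of `T`. The size condition
      -- missing from `Robust` comes from the degree: a vertex of `B` has at least `m + 2`
      -- neighbours, of which at most `m` are on `T`, so two more lie in `B`.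
      spanning⇒solution : ∀ {B} → Robust B → (T : Copy B) → (∀ v → v ∉ B → v ∈ˡ Copy.vertices T) →
        Σ (Fin (r + 3 + ℓ) → V) (λ f → IsPSEmbedding G r (r + 3 + ℓ) f × TwoConnectedOn G (outside f))
      spanning⇒solution {B} robust T span =
        embed T , embed-isEmbedding T ,
        subst (TwoConnectedOn G) B≡outside (three , connected , λ x _ → minus x)
        where
        open Robust robust
        open Copy T
        inB : ∀ v → v ∉ˡ vertices → v ∈ B
        inB v v∉ with v ∈? B
        ... | yes p = p
        ... | no ¬p = contradiction (span v ¬p) v∉
        adj⇒≢ : ∀ {u v} → Adj G u v → v ≢ u
        adj⇒≢ a refl = Graph.irrefl G a
        none : ∀ {v} → Covered v ⊥ 0
        none = [] , z≤n , λ u∈ _ → contradiction u∈ ∉⊥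
        room : ∀ v → 2 + length vertices ≤ degree G v
        room v = ≤-trans (≤-reflexive (trans (cong (2 +_) ∣vertices∣) (arith r ℓ))) (large v)
          where
          arith : ∀ r ℓ → 2 + (r + 3 + ℓ) ≡ 5 + (r + ℓ)
          arith = solve-∀
        B≡outside : B ≡ outside (embed T)
        B≡outside = ⊆-antisym
          (λ v∈ → ∈-outside⁺ (embed T) λ { i refl → All.lookup avoids (embed-∈ T i) v∈ })
          (λ {v} v∈ → inB v (λ p → let i , eq = ∈-embed T p in ∈-outside⁻ (embed T) v∈ i eq))
        three : 3 ≤ ∣ B ∣
        three =
          let v , _ , v∈ , _    = two
              y , vy , _ , y∉ = escape none vertices (≤-trans (s≤s (m≤n+m _ 1)) (room v))
              z , vz , _ , z∉ = escape none (y ∷ vertices) (room v)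
          in three-elements v∈ (inB y y∉) (inB z (z∉ ∘ there))
               (adj⇒≢ vy) (adj⇒≢ vz) (z∉ ∘ here)

theorem3p3 : (m r : ℕ) → 1 ≤ r → r + 3 ≤ m →
    (n : ℕ) (G : Graph n) → TwoConnected G → MinDegree≥ G (m + 2) →
    Σ (Fin m → Fin n) (λ f → IsPSEmbedding G r m f × TwoConnectedOn G (outside f))
-- With no vertices the size condition fails; otherwise vertex `fzero` is available as an end of the
-- first edge.
theorem3p3 m r _ r+3≤m zero G (() , _) _
theorem3p3 m r _ r+3≤m n@(suc _) G two-conn δ with m≤n⇒∃[o]m+o≡n r+3≤m
... | ℓ , refl =
  let B , robust , T            = edge-and-copy G r ℓ large fzero
      B′ , robust′ , T′ , spans = maximal G r ℓ large two-conn _ ≤-refl robust T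
  in spanning⇒solution G r ℓ large robust′ T′ spans
  where
  arith : ∀ r ℓ → 5 + (r + ℓ) ≡ r + 3 + ℓ + 2
  arith = solve-∀
  large : ∀ v → 5 + (r + ℓ) ≤ degree G v
  large v = ≤-trans (≤-reflexive (arith r ℓ)) (δ v)
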